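{- The collection $\{1324, 2314, 3214, 4213\}$ is inversion monotone; that is, $\mathrm{av}_n^k(1324,2314,3214,4213)\le \mathrm{av}_{n+1}^k(1324,2314,3214,4213)$ for all integers $n,k\ge 0$.
   Context: A permutation $\pi\in S_n$ contains a pattern $p \in S_m$ if $\pi$ (in one-line notation) has a subsequence order-isomorphic to $p$; otherwise $\pi$ avoids $p$. An inversion of $\pi$ is a pair $i<j$ with $\pi_i>\pi_j$. For a set $B$ of patterns, $\mathrm{av}_n^k(B)$ is the number of permutations in $S_n$ with exactly $k$ inversions that avoid every pattern in $B$. $B$ is called inversion monotone if $\mathrm{av}_n^k(B)\le \mathrm{av}_{n+1}^k(B)$ for all $n$ and $k$. -}

module Defs where

open import Data.Fin using (Fin; zero; suc; toℕ; _<_; punchIn)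
open import Data.Fin.Patterns using (0F; 1F; 2F; 3F)
open import Data.Fin.Permutation
  using (Permutation′; permutation; _⟨$⟩ʳ_; _≈_; id; insert; remove; insert-punchIn; insert-remove)
open import Data.Fin.Properties using (_≟_; _<?_; all?; any?; punchIn-injective)
open import Data.List using (List; []; _∷_; allFin; cartesianProduct; cartesianProductWith; filter; length)
import Data.List.Membership.Setoid as Membership
open import Data.List.Membership.Propositional.Properties using (∈-allFin)
open import Data.List.Membership.Setoid.Properties using (∈-cartesianProductWith⁺; ∈-resp-≈)
open import Data.List.Relation.Unary.All using (All)
import Data.List.Relation.Unary.All as All
open import Data.List.Relation.Unary.Any using (here)
open import Data.List.Relation.Unary.AllPairs using ([]; _∷_)
import Data.List.Relation.Unary.Unique.Setoid as Unique
open import Data.List.Relation.Unary.Unique.Propositional.Properties using (allFin⁺)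
open import Data.List.Relation.Unary.Unique.Setoid.Properties using (cartesianProductWith⁺)
open import Data.Nat using (ℕ; zero; suc; _≤_)
import Data.Nat.Properties as ℕ
open import Data.Product using (Σ; ∃; _×_; _,_; uncurry; <_,_>)
open import Data.Vec using (Vec; []; _∷_; lookup; tabulate)
open import Function using (_∘_; _⇔_; mk⇔; Equivalence)
open import Level using (0ℓ)
open import Relation.Binary using (Setoid)
open import Relation.Binary.PropositionalEquality
  using (_≡_; refl; sym; trans; cong; module ≡-Reasoning) renaming (setoid to ≡-setoid)
open import Relation.Nullary using (Dec; ¬_)
open import Relation.Nullary.Decidable using (True; toWitness; map′; _×-dec_; _→-dec_; ¬?)
open import Relation.Unary using (Decidable)

private
  variable
    m n o : ℕ

-- Positions and values are numbered from 0: the one-line entry π_{i+1} is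
-- toℕ (π ⟨$⟩ʳ i) + 1.

oneLine : (w w⁻¹ : Vec (Fin n) n)
          {_ : True (all? λ i → lookup w (lookup w⁻¹ i) ≟ i)}
          {_ : True (all? λ i → lookup w⁻¹ (lookup w i) ≟ i)} →
          Permutation′ n
oneLine w w⁻¹ {l} {r} = permutation (lookup w) (lookup w⁻¹) (toWitness l) (toWitness r)

word : Permutation′ n → Vec ℕ n
word π = tabulate λ i → suc (toℕ (π ⟨$⟩ʳ i))

Inversion : Permutation′ n → Fin n × Fin n → Set
Inversion π (i , j) = i < j × π ⟨$⟩ʳ j < π ⟨$⟩ʳ i

inversion? : (π : Permutation′ n) → Decidable (Inversion π)
inversion? π (i , j) = i <? j ×-dec π ⟨$⟩ʳ j <? π ⟨$⟩ʳ i

inversions : Permutation′ n → ℕ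
inversions {n} π = length (filter (inversion? π) (cartesianProduct (allFin n) (allFin n)))

OrderIsomorphic : (Fin m → Fin n) → (Fin m → Fin o) → Set
OrderIsomorphic u v = ∀ i j → u i < u j ⇔ v i < v j

StrictlyIncreasing : (Fin m → Fin n) → Set
StrictlyIncreasing f = ∀ i j → i < j → f i < f j

-- The vector lists the positions in π of the entries of the subsequence.
Occurrence : Permutation′ n → Permutation′ m → Vec (Fin n) m → Set
Occurrence π p is =
  StrictlyIncreasing (lookup is) × OrderIsomorphic (λ a → π ⟨$⟩ʳ lookup is a) (p ⟨$⟩ʳ_)

infix 4 _Contains_ _Contains?_

_Contains_ : Permutation′ n → Permutation′ m → Set
π Contains p = ∃ (Occurrence π p)

Pattern : Set
Pattern = Σ ℕ Permutation′

Avoids : List Pattern → Permutation′ n → Set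
Avoids B π = All (λ (_ , p) → ¬ π Contains p) B

private
  anyVec? : ∀ {m} {P : Vec (Fin n) m → Set} → Decidable P → Dec (∃ P)
  anyVec? {m = zero}  P? = map′ ([] ,_) (λ { ([] , p) → p }) (P? [])
  anyVec? {m = suc m} P? =
    map′ (λ (x , xs , p) → x ∷ xs , p) (λ { (x ∷ xs , p) → x , xs , p })
         (any? λ x → anyVec? λ xs → P? (x ∷ xs))

  infix 2 _⇔-dec_

  _⇔-dec_ : {A B : Set} → Dec A → Dec B → Dec (A ⇔ B)
  A? ⇔-dec B? = map′ (uncurry mk⇔) < Equivalence.to , Equivalence.from >
                     ((A? →-dec B?) ×-dec (B? →-dec A?))

occurrence? : (π : Permutation′ n) (p : Permutation′ m) → Decidable (Occurrence π p)
occurrence? π p is =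
  (all? λ i → all? λ j → i <? j →-dec lookup is i <? lookup is j)
  ×-dec
  (all? λ i → all? λ j →
    π ⟨$⟩ʳ lookup is i <? π ⟨$⟩ʳ lookup is j ⇔-dec p ⟨$⟩ʳ i <? p ⟨$⟩ʳ j)

_Contains?_ : (π : Permutation′ n) (p : Permutation′ m) → Dec (π Contains p)
π Contains? p = anyVec? (occurrence? π p)

avoids? : (B : List Pattern) → Decidable (Avoids {n} B)
avoids? B π = All.all? (λ (_ , p) → ¬? (π Contains? p)) B

-- S_n, listed by choosing the first entry j and a permutation of the remaining
-- values.  By permutations-complete and permutations-unique below, each
-- permutation occurs exactly once up to pointwise equality.
permutations : ∀ n → List (Permutation′ n)
permutations zero    = id ∷ []
permutations (suc n) = cartesianProductWith (insert zero) (allFin (suc n)) (permutations n)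

av : ℕ → ℕ → List Pattern → ℕ
av n k B = length (filter (λ π → inversions π ℕ.≟ k ×-dec avoids? B π) (permutations n))

InversionMonotone : List Pattern → Set
InversionMonotone B = ∀ n k → av n k B ≤ av (suc n) k B

p1324 p2314 p3214 p4213 : Permutation′ 4
p1324 = oneLine (0F ∷ 2F ∷ 1F ∷ 3F ∷ []) (0F ∷ 2F ∷ 1F ∷ 3F ∷ [])
p2314 = oneLine (1F ∷ 2F ∷ 0F ∷ 3F ∷ []) (2F ∷ 0F ∷ 1F ∷ 3F ∷ [])
p3214 = oneLine (2F ∷ 1F ∷ 0F ∷ 3F ∷ []) (2F ∷ 1F ∷ 0F ∷ 3F ∷ [])
p4213 = oneLine (3F ∷ 1F ∷ 0F ∷ 2F ∷ []) (2F ∷ 1F ∷ 3F ∷ 0F ∷ [])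

_ : word p1324 ≡ 1 ∷ 3 ∷ 2 ∷ 4 ∷ []
_ = refl

_ : word p2314 ≡ 2 ∷ 3 ∷ 1 ∷ 4 ∷ []
_ = refl

_ : word p3214 ≡ 3 ∷ 2 ∷ 1 ∷ 4 ∷ []
_ = refl

_ : word p4213 ≡ 4 ∷ 2 ∷ 1 ∷ 3 ∷ []
_ = refl

permutationSetoid : ℕ → Setoid 0ℓ 0ℓ
permutationSetoid n = record
  { Carrier       = Permutation′ n
  ; _≈_           = _≈_
  ; isEquivalence = record
    { refl  = λ _ → refl
    ; sym   = λ p i → sym (p i)
    ; trans = λ p q i → trans (p i) (q i)
    }
  }

private
  insert-cong : ∀ {j k} {π ρ : Permutation′ n} → j ≡ k → π ≈ ρ →
                insert zero j π ≈ insert zero k ρ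
  insert-cong refl π≈ρ zero    = refl
  insert-cong {j = j} {π = π} {ρ} refl π≈ρ (suc i) = begin
    insert zero j π ⟨$⟩ʳ suc i  ≡⟨ insert-punchIn zero j π i ⟩
    punchIn j (π ⟨$⟩ʳ i)        ≡⟨ cong (punchIn j) (π≈ρ i) ⟩
    punchIn j (ρ ⟨$⟩ʳ i)        ≡⟨ insert-punchIn zero j ρ i ⟨
    insert zero j ρ ⟨$⟩ʳ suc i  ∎
    where open ≡-Reasoning

  insert-injective : ∀ {j k} {π ρ : Permutation′ n} →
                     insert zero j π ≈ insert zero k ρ → j ≡ k × π ≈ ρ
  insert-injective {j = j} {π = π} {ρ} eq with refl ← eq zero =
    refl , λ i → punchIn-injective j _ _ (begin
      punchIn j (π ⟨$⟩ʳ i)        ≡⟨ insert-punchIn zero j π i ⟨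
      insert zero j π ⟨$⟩ʳ suc i  ≡⟨ eq (suc i) ⟩
      insert zero j ρ ⟨$⟩ʳ suc i  ≡⟨ insert-punchIn zero j ρ i ⟩
      punchIn j (ρ ⟨$⟩ʳ i)        ∎)
    where open ≡-Reasoning

permutations-complete : (π : Permutation′ n) → let open Membership (permutationSetoid n) in
                        π ∈ permutations n
permutations-complete {zero}  π = here λ ()
permutations-complete {suc n} π =
  ∈-resp-≈ S {x = insert zero (π ⟨$⟩ʳ zero) (remove zero π)} {y = π} (insert-remove zero π)
  (∈-cartesianProductWith⁺ (≡-setoid _) (permutationSetoid n) S
    (λ {_} {_} {ρ} {σ} → insert-cong {π = ρ} {σ})
    (∈-allFin (π ⟨$⟩ʳ zero)) (permutations-complete (remove zero π)))
  where S = permutationSetoid (suc n)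

permutations-unique : ∀ n → Unique.Unique (permutationSetoid n) (permutations n)
permutations-unique zero    = All.[] ∷ []
permutations-unique (suc n) =
  cartesianProductWith⁺ (≡-setoid _) (permutationSetoid n) (permutationSetoid (suc n))
    (insert zero) (λ {_} {_} {π} {ρ} → insert-injective {π = π} {ρ})
    (allFin⁺ (suc n)) (permutations-unique n)

{-# OPTIONS --safe #-}

-- In each of the four patterns the last three entries form a 213, and the four
-- first entries realise all positions relative to those three.  Hence π avoids
-- B exactly when π without its first entry avoids 213.  Inserting a new minimum
-- right after the first entry of π creates no 213 there, keeps the number of
-- inversions, and is injective.

module Submission where

open import Defs
open import Data.Bool using (true; false; if_then_else_)
open import Data.Empty using (⊥)
open import Data.Fin using (Fin; zero; suc; toℕ; _<_; punchIn; inject₁)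
open import Data.Fin.Patterns using (0F; 1F; 2F; 3F)
open import Data.Fin.Permutation
  using (Permutation′; _⟨$⟩ʳ_; _⟨$⟩ˡ_; id; insert; inverseˡ)
open import Data.Fin.Properties
  using (_<?_; <-cmp; <-trans; <-asym; <-irrefl; toℕ-inject₁; punchIn-cancel-≤; punchIn-mono-≤)
open import Data.List
  using (List; []; _∷_; _++_; cartesianProduct; cartesianProductWith; filter; length; map; tabulate)
open import Data.List.Properties using (filter-++; length-++; map-id; map-tabulate)
open import Data.List.Relation.Binary.Sublist.Heterogeneous using (Sublist; []; _∷_; _∷ʳ_; minimum)
  renaming (map to Sublist-map)
import Data.List.Relation.Binary.Pointwise as Pointwise
import Data.List.Relation.Binary.Sublist.Heterogeneous.Properties as Sublist
open import Data.List.Relation.Unary.All using ([]; _∷_)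
open import Data.Nat using (ℕ; zero; suc; _+_; _≤_; z≤n; s≤s; s≤s⁻¹)
import Data.Nat as ℕ using (_<_)
import Data.Nat.Properties as ℕ
open import Algebra.Properties.CommutativeMonoid.Sum ℕ.+-0-commutativeMonoid
  using (sum-syntax; sum-cong-≗; sum-permute)
open import Data.Product using (∃; _×_; _,_)
open import Data.Vec using (Vec; []; _∷_; lookup)
import Data.Vec as Vec
open import Data.Vec.Properties using (lookup∘tabulate)
open import Data.Vec.Relation.Unary.Linked using (Linked; [-]; _∷_)
open import Data.Vec.Relation.Unary.Linked.Properties using (lookup⁺)
open import Function using (_∘_; _⇔_; mk⇔; Equivalence)
open import Level using (0ℓ)
open import Relation.Binary using (REL; tri<; tri≈; tri>)
open import Relation.Binary.PropositionalEquality
  using (_≡_; refl; sym; trans; cong; cong₂; subst; subst₂; module ≡-Reasoning)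
open import Relation.Nullary using (Dec; does; yes; no; ¬_; contradiction)
open import Relation.Nullary.Decidable using (does-⇔; True; toWitness; _×-dec_)
open import Relation.Unary using (Pred; Decidable)

private
  variable
    m n : ℕ
    A A′ B B′ C C′ : Set

-- Order-preserving matchings between lists.

cartesianProductWith-Sublist :
  {R : REL A A′ 0ℓ} {S : REL B B′ 0ℓ} {T : REL C C′ 0ℓ} {f : A → B → C} {g : A′ → B′ → C′} →
  (∀ {x x′ y y′} → R x x′ → S y y′ → T (f x y) (g x′ y′)) →
  ∀ {xs xs′ ys ys′} → Sublist R xs xs′ → Sublist S ys ys′ →
  Sublist T (cartesianProductWith f xs ys) (cartesianProductWith g xs′ ys′)
cartesianProductWith-Sublist h []       s = []
cartesianProductWith-Sublist h (x ∷ʳ r) s = Sublist.++ˡ _ (cartesianProductWith-Sublist h r s)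
cartesianProductWith-Sublist {f = f} {g} h (_∷_ {x} {_} {y} p r) s =
  Sublist.++⁺ (Sublist.map⁺ (f x) (g y) (Sublist-map (h p) s)) (cartesianProductWith-Sublist h r s)

-- Only the last entry of the longer list stays unmatched, so matched entries keep their index, as
-- `inject₁` does.
tabulate-Sublist : {R : REL A B 0ℓ} (f : Fin m → A) (g : Fin (suc m) → B) →
                   (∀ i → R (f i) (g (inject₁ i))) → Sublist R (tabulate f) (tabulate g)
tabulate-Sublist {m = zero}  f g h = minimum _
tabulate-Sublist {m = suc m} f g h =
  h zero ∷ tabulate-Sublist (f ∘ suc) (g ∘ suc) (h ∘ suc)

-- `punchIn` and the order of values.

punchIn-cancel-< : ∀ (i : Fin (suc n)) {j k} → punchIn i j < punchIn i k → j < k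
punchIn-cancel-< i lt = ℕ.≰⇒> λ k≤j → ℕ.<⇒≱ lt (punchIn-mono-≤ i _ _ k≤j)

punchIn-mono-< : ∀ (i : Fin (suc n)) {j k} → j < k → punchIn i j < punchIn i k
punchIn-mono-< i j<k = ℕ.≰⇒> λ le → ℕ.<⇒≱ j<k (punchIn-cancel-≤ i _ _ le)

punchIn-below : ∀ (i : Fin (suc n)) k → toℕ k ℕ.< toℕ i → punchIn i k < i
punchIn-below (suc i) zero    k<i = s≤s z≤n
punchIn-below (suc i) (suc k) k<i = s≤s (punchIn-below i k (s≤s⁻¹ k<i))

punchIn-above : ∀ (i : Fin (suc n)) k → toℕ i ≤ toℕ k → i < punchIn i k
punchIn-above zero    k       i≤k = s≤s z≤n
punchIn-above (suc i) (suc k) i≤k = s≤s (punchIn-above i k (s≤s⁻¹ i≤k))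

punchIn-below-⇔ : ∀ (i : Fin (suc n)) k → punchIn i k < i ⇔ toℕ k ℕ.< toℕ i
punchIn-below-⇔ i k = mk⇔
  (λ lt → ℕ.≰⇒> λ i≤k → ℕ.<-asym lt (punchIn-above i k i≤k))
  (punchIn-below i k)

-- Inversions as a double sum.

indicator : Dec A → ℕ
indicator a? = if does a? then 1 else 0

length-filter-tabulate : {P : Pred A 0ℓ} (P? : Decidable P) (f : Fin n → A) →
                         length (filter P? (tabulate f)) ≡ ∑[ i < n ] indicator (P? (f i))
length-filter-tabulate {n = zero}  P? f = refl
length-filter-tabulate {n = suc n} P? f with does (P? (f zero))
... | true  = cong suc (length-filter-tabulate P? (f ∘ suc))
... | false = length-filter-tabulate P? (f ∘ suc)

length-filter-cartesianProduct :
  {P : Pred (A × B) 0ℓ} (P? : Decidable P) (f : Fin m → A) (g : Fin n → B) →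
  length (filter P? (cartesianProduct (tabulate f) (tabulate g)))
    ≡ ∑[ i < m ] ∑[ j < n ] indicator (P? (f i , g j))
length-filter-cartesianProduct {m = zero}          P? f g = refl
length-filter-cartesianProduct {m = suc m} {n = n} P? f g = begin
  length (filter P? (row ++ rest))
    ≡⟨ cong length (filter-++ P? row rest) ⟩
  length (filter P? row ++ filter P? rest)
    ≡⟨ length-++ (filter P? row) ⟩
  length (filter P? row) + length (filter P? rest)
    ≡⟨ cong₂ _+_
         (trans (cong (length ∘ filter P?) (map-tabulate g (f zero ,_)))
                (length-filter-tabulate P? ((f zero ,_) ∘ g)))
         (length-filter-cartesianProduct P? (f ∘ suc) g) ⟩
  ∑[ i < suc m ] ∑[ j < n ] indicator (P? (f i , g j)) ∎
  where
  open ≡-Reasoning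
  row  = map (f zero ,_) (tabulate g)
  rest = cartesianProduct (tabulate (f ∘ suc)) (tabulate g)

inversions-∑ : (π : Permutation′ n) →
               inversions π ≡ ∑[ i < n ] ∑[ j < n ] indicator (inversion? π (i , j))
inversions-∑ π = length-filter-cartesianProduct (inversion? π) (λ i → i) (λ i → i)

∑-below : (j : Fin (suc n)) → ∑[ i < n ] indicator (toℕ i ℕ.<? toℕ j) ≡ toℕ j
∑-below {zero}  zero    = refl
∑-below {suc n} zero    = ∑-below {n} zero
∑-below {suc n} (suc j) = cong suc (∑-below j)

-- The first entry exceeds exactly the `toℕ j` smaller values, all of which follow it. Since
-- `punchIn j` is monotone, the pairs among the remaining entries contribute the inversions of `σ`.
inversions-insert : (j : Fin (suc n)) (σ : Permutation′ n) →
                    inversions (insert zero j σ) ≡ toℕ j + inversions σ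
inversions-insert {n} j σ = begin
  inversions (insert zero j σ)
    -- Terms whose second position is zero vanish by computation; the rest of the first row reduces
    -- to comparisons with `j`.
    ≡⟨ inversions-∑ (insert zero j σ) ⟩
  ∑[ k < n ] indicator (punchIn j (σ ⟨$⟩ʳ k) <? j) +
  ∑[ i < n ] ∑[ k < n ] indicator (inversion? (insert zero j σ) (suc i , suc k))
    ≡⟨ cong₂ _+_
         (sum-cong-≗ λ k → indicator-⇔ (punchIn-below-⇔ j (σ ⟨$⟩ʳ k)) (_ <? _) (_ ℕ.<? _))
         (sum-cong-≗ λ i → sum-cong-≗ λ k → indicator-⇔ (inversion-suc i k)
           (inversion? (insert zero j σ) (suc i , suc k)) (inversion? σ (i , k))) ⟩
  ∑[ k < n ] indicator (toℕ (σ ⟨$⟩ʳ k) ℕ.<? toℕ j) +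
  ∑[ i < n ] ∑[ k < n ] indicator (inversion? σ (i , k))
    -- As `σ` is a bijection, the first sum may run over the values themselves.
    ≡⟨ cong₂ _+_ (sum-permute (λ k → indicator (toℕ k ℕ.<? toℕ j)) σ) (inversions-∑ σ) ⟨
  ∑[ k < n ] indicator (toℕ k ℕ.<? toℕ j) + inversions σ
    ≡⟨ cong (_+ inversions σ) (∑-below j) ⟩
  toℕ j + inversions σ ∎
  where
  open ≡-Reasoning
  indicator-⇔ : A ⇔ B → (a? : Dec A) (b? : Dec B) → indicator a? ≡ indicator b?
  indicator-⇔ A⇔B a? b? = cong (if_then 1 else 0) (does-⇔ A⇔B a? b?)
  inversion-suc : ∀ i k → Inversion (insert zero j σ) (suc i , suc k) ⇔ Inversion σ (i , k)
  inversion-suc i k = mk⇔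
    (λ (i<k , lt) → s≤s⁻¹ i<k , punchIn-cancel-< j lt)
    (λ (i<k , lt) → s≤s i<k , punchIn-mono-< j lt)

-- Pattern occurrences and 213.

-- Reading the chosen entries through `p ⟨$⟩ˡ_` lists them by increasing pattern value. If that list
-- increases, order is preserved by transitivity and reflected by trichotomy, so a chain of
-- consecutive comparisons suffices.
occurrence : (π : Permutation′ n) (p : Permutation′ m) {is : Vec (Fin n) m} →
             Linked _<_ is → Linked _<_ (Vec.tabulate λ v → π ⟨$⟩ʳ lookup is (p ⟨$⟩ˡ v)) →
             Occurrence π p is
occurrence {n} {m} π p {is} is↑ vs↑ =
  (λ _ _ → lookup⁺ <-trans is↑) , λ a b → mk⇔ (reflects a b) (preserves a b)
  where
  u : Fin m → Fin n
  u a = π ⟨$⟩ʳ lookup is a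
  vs : Vec (Fin n) m
  vs = Vec.tabulate λ v → u (p ⟨$⟩ˡ v)
  value : ∀ a → lookup vs (p ⟨$⟩ʳ a) ≡ u a
  value a = trans (lookup∘tabulate _ (p ⟨$⟩ʳ a)) (cong u (inverseˡ p))
  preserves : ∀ a b → p ⟨$⟩ʳ a < p ⟨$⟩ʳ b → u a < u b
  preserves a b lt = subst₂ _<_ (value a) (value b) (lookup⁺ <-trans vs↑ lt)
  reflects : ∀ a b → u a < u b → p ⟨$⟩ʳ a < p ⟨$⟩ʳ b
  reflects a b lt with <-cmp (p ⟨$⟩ʳ a) (p ⟨$⟩ʳ b)
  ... | tri< pa<pb _ _ = pa<pb
  ... | tri≈ _ pa≡pb _ =
    contradiction lt (<-irrefl (trans (sym (value a)) (trans (cong (lookup vs) pa≡pb) (value b))))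
  ... | tri> _ _ pb<pa = contradiction (preserves b a pb<pa) (<-asym lt)

Contains213 : Permutation′ n → Set
Contains213 {n} σ = ∃ λ ((a , b , c) : Fin n × Fin n × Fin n) →
  a < b × b < c × σ ⟨$⟩ʳ b < σ ⟨$⟩ʳ a × σ ⟨$⟩ʳ a < σ ⟨$⟩ʳ c

insert-contains⇒contains213 :
  (j : Fin (suc n)) (σ : Permutation′ n) (p : Permutation′ 4) →
  p ⟨$⟩ʳ 2F < p ⟨$⟩ʳ 1F → p ⟨$⟩ʳ 1F < p ⟨$⟩ʳ 3F →
  insert zero j σ Contains p → Contains213 σ
insert-contains⇒contains213 j σ p p₂<p₁ p₁<p₃ (_ ∷ b ∷ c ∷ d ∷ [] , inc , iso)
  with b | c | d | inc 0F 1F (s≤s z≤n) | inc 1F 2F (s≤s (s≤s z≤n)) | inc 2F 3F (s≤s (s≤s (s≤s z≤n)))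
     | Equivalence.from (iso 2F 1F) p₂<p₁ | Equivalence.from (iso 1F 3F) p₁<p₃
-- Each of the last three positions exceeds another position, so none is zero, wherever the
-- occurrence begins.
... | suc b | suc c | suc d | _ | b<c | c<d | c<b | b<d =
  (b , c , d) , s≤s⁻¹ b<c , s≤s⁻¹ c<d , punchIn-cancel-< j c<b , punchIn-cancel-< j b<d

-- The new minimum comes first, but the first entry of a 213 exceeds its second, so the new entry
-- takes no part.
insert-minimum-contains213 : (σ : Permutation′ n) → Contains213 (insert zero zero σ) → Contains213 σ
insert-minimum-contains213 σ ((suc a , suc b , suc c) , a<b , b<c , σb<σa , σa<σc) =
  (a , b , c) , s≤s⁻¹ a<b , s≤s⁻¹ b<c , s≤s⁻¹ σb<σa , s≤s⁻¹ σa<σc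

patterns : List Pattern
patterns = (4 , p1324) ∷ (4 , p2314) ∷ (4 , p3214) ∷ (4 , p4213) ∷ []

avoids⇒¬contains213 : (j : Fin (suc n)) (σ : Permutation′ n) →
                      Avoids patterns (insert zero j σ) → ¬ Contains213 σ
avoids⇒¬contains213 {n} j σ (¬1324 ∷ ¬2314 ∷ ¬3214 ∷ ¬4213 ∷ [])
                    ((a , b , c) , a<b , b<c , σb<σa , σa<σc) = compare
  (toℕ (σ ⟨$⟩ʳ b) ℕ.<? toℕ j) (toℕ (σ ⟨$⟩ʳ a) ℕ.<? toℕ j) (toℕ (σ ⟨$⟩ʳ c) ℕ.<? toℕ j)
  where
  π = insert zero j σ
  is = zero ∷ suc a ∷ suc b ∷ suc c ∷ []
  positions : Linked _<_ is
  positions = s≤s z≤n ∷ s≤s a<b ∷ s≤s b<c ∷ [-]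
  b<a : π ⟨$⟩ʳ suc b < π ⟨$⟩ʳ suc a
  b<a = punchIn-mono-< j σb<σa
  a<c : π ⟨$⟩ʳ suc a < π ⟨$⟩ʳ suc c
  a<c = punchIn-mono-< j σa<σc
  below : ∀ {i} → toℕ (σ ⟨$⟩ʳ i) ℕ.< toℕ j → π ⟨$⟩ʳ suc i < j
  below = punchIn-below j _
  -- A value equal to `j` is shifted above it by `punchIn`, so the weak inequality becomes strict.
  above : ∀ {i} → ¬ toℕ (σ ⟨$⟩ʳ i) ℕ.< toℕ j → j < π ⟨$⟩ʳ suc i
  above ≮j = punchIn-above j _ (ℕ.≮⇒≥ ≮j)
  compare : Dec (toℕ (σ ⟨$⟩ʳ b) ℕ.< toℕ j) → Dec (toℕ (σ ⟨$⟩ʳ a) ℕ.< toℕ j) →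
            Dec (toℕ (σ ⟨$⟩ʳ c) ℕ.< toℕ j) → ⊥
  -- In turn `j` lies below the 213, in its lower gap, in its upper gap and above it; each chain
  -- lists the four values in increasing order.
  compare (no b≮j) _ _ =
    ¬1324 (is , occurrence π p1324 positions (above b≮j ∷ b<a ∷ a<c ∷ [-]))
  compare (yes b<j) (no a≮j) _ =
    ¬2314 (is , occurrence π p2314 positions (below b<j ∷ above a≮j ∷ a<c ∷ [-]))
  compare _ (yes a<j) (no c≮j) =
    ¬3214 (is , occurrence π p3214 positions (b<a ∷ below a<j ∷ above c≮j ∷ [-]))
  compare _ _ (yes c<j) =
    ¬4213 (is , occurrence π p4213 positions (b<a ∷ a<c ∷ below c<j ∷ [-]))

¬contains213⇒avoids : (j : Fin (suc n)) (σ : Permutation′ n) →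
                      ¬ Contains213 σ → Avoids patterns (insert zero j σ)
¬contains213⇒avoids j σ ¬213 =
  avoid p1324 ∷ avoid p2314 ∷ avoid p3214 ∷ avoid p4213 ∷ []
  where
  -- The `True` arguments are settled by evaluation: the last three entries of each concrete pattern
  -- form a 213.
  avoid : (p : Permutation′ 4) {_ : True (p ⟨$⟩ʳ 2F <? p ⟨$⟩ʳ 1F)}
          {_ : True (p ⟨$⟩ʳ 1F <? p ⟨$⟩ʳ 3F)} → ¬ insert zero j σ Contains p
  avoid p {p₂<p₁} {p₁<p₃} =
    ¬213 ∘ insert-contains⇒contains213 j σ p (toWitness p₂<p₁) (toWitness p₁<p₃)

-- Matching permutations of consecutive sizes.

infix 4 _↝[_]_

_↝[_]_ : Permutation′ m → List Pattern → Permutation′ n → Set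
π ↝[ B ] ρ = inversions π ≡ inversions ρ × (Avoids B π → Avoids B ρ)

-- The sublist plays the part of the injection: it sends entries of `xs` to distinct positions of
-- `ys`, and an entry that passes `P?` is sent to one that passes `Q?`.
length-filter-mono :
  {P : Pred A 0ℓ} {Q : Pred B 0ℓ} (P? : Decidable P) (Q? : Decidable Q) {xs : List A} {ys : List B} →
  Sublist (λ x y → P x → Q y) xs ys → length (filter P? xs) ≤ length (filter Q? ys)
length-filter-mono P? Q? xs⊆ys =
  Sublist.length-mono-≤ (Sublist.⊆-filter-Sublist P? Q? (λ P⇒Q → P⇒Q) xs⊆ys)

av-mono : ∀ m n B k → Sublist (λ π ρ → π ↝[ B ] ρ) (permutations m) (permutations n) →
          av m k B ≤ av n k B
av-mono m n B k πs↝ρs = length-filter-mono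
  (λ π → inversions π ℕ.≟ k ×-dec avoids? B π) (λ ρ → inversions ρ ℕ.≟ k ×-dec avoids? B ρ)
  (Sublist-map (λ {π} {ρ} → transfer {π} {ρ}) πs↝ρs)
  where
  Counted : ∀ {o} → Permutation′ o → Set
  Counted π = inversions π ≡ k × Avoids B π
  transfer : {π : Permutation′ m} {ρ : Permutation′ n} → π ↝[ B ] ρ → Counted π → Counted ρ
  transfer (inv , avoid) (inv≡k , av) = trans (sym inv) inv≡k , avoid av

-- The added entry is a minimum of the tail, while the first entry keeps its value `toℕ j` and hence
-- its number of inversions. Its rank among the old tail entries may change, which is harmless
-- because avoidance depends on the tail alone.
insert-minimum-second : ∀ {j : Fin (suc n)} {j′ : Fin (suc (suc n))} {σ : Permutation′ n}
                        {ρ : Permutation′ (suc n)} → toℕ j ≡ toℕ j′ → insert zero zero σ ≡ ρ →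
                        insert zero j σ ↝[ patterns ] insert zero j′ ρ
insert-minimum-second {j = j} {j′} {σ} eq refl = inv , avoid
  where
  open ≡-Reasoning
  ρ = insert zero zero σ
  inv : inversions (insert zero j σ) ≡ inversions (insert zero j′ ρ)
  inv = begin
    inversions (insert zero j σ)   ≡⟨ inversions-insert j σ ⟩
    toℕ j + inversions σ           ≡⟨ cong₂ _+_ eq (sym (inversions-insert zero σ)) ⟩
    toℕ j′ + inversions ρ          ≡⟨ inversions-insert j′ ρ ⟨
    inversions (insert zero j′ ρ)  ∎
  avoid : Avoids patterns (insert zero j σ) → Avoids patterns (insert zero j′ ρ)
  avoid av = ¬contains213⇒avoids j′ ρ
    (avoids⇒¬contains213 j σ av ∘ insert-minimum-contains213 σ)

-- The longer enumeration opens with the block of first entry zero, which is the image of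
-- `permutations n` in the same order; all later blocks are skipped.
permutations-insert-minimum :
  ∀ n → Sublist (λ σ ρ → insert zero zero σ ≡ ρ) (permutations n) (permutations (suc n))
permutations-insert-minimum n =
  Sublist.++ʳ _ (subst
    (λ σs → Sublist (λ σ ρ → insert zero zero σ ≡ ρ) σs (map (insert zero zero) (permutations n)))
    (map-id (permutations n))
    (Sublist.map⁺ (λ σ → σ) (insert zero zero) (Sublist.fromPointwise (Pointwise.refl refl))))

permutations-↝ : ∀ n → Sublist (λ π ρ → π ↝[ patterns ] ρ) (permutations n) (permutations (suc n))
permutations-↝ zero =
  -- The empty permutation has no first entry, so it is matched directly with the only permutation
  -- of size one, whose empty tail contains no 213.
  (sym (inversions-insert {zero} zero id) , λ _ → ¬contains213⇒avoids {zero} zero id λ ()) ∷ []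
-- Both enumerations are products of first entries and tails, so the two factors are matched
-- separately.
permutations-↝ (suc n) = cartesianProductWith-Sublist
  {R = λ j j′ → toℕ j ≡ toℕ j′} {f = insert zero} {g = insert zero} insert-minimum-second
  (tabulate-Sublist (λ i → i) (λ i → i) (λ i → sym (toℕ-inject₁ i)))
  (permutations-insert-minimum n)

proposition4p3 : InversionMonotone ((4 , p1324) ∷ (4 , p2314) ∷ (4 , p3214) ∷ (4 , p4213) ∷ [])
proposition4p3 n k = av-mono n (suc n) patterns k (permutations-↝ n)
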